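{- Let $\Sigma=(\mathsf{P}_\Sigma,\mathsf{R}_\Sigma,\rho^\Sigma)$ be a PR-structure. Then $\Sigma$ is preorderal if and only if the following two conditions are satisfied: (1) there exists $\mathbf{i}\in \mathsf{R}_\Sigma$ such that $\mathbf{i}\in \rho^\Sigma(a,a)$ for every $a\in \mathsf{P}_\Sigma$; (2) for every $r,s\in \mathsf{R}_\Sigma$ there exists (in general not unique) $s\Box r\in \mathsf{R}_\Sigma$ such that for every $a,b,c\in \mathsf{P}_\Sigma$, $s\Box r\in \rho^\Sigma(a,c)$ whenever $r\in \rho^\Sigma(a,b)$ and $s\in \rho^\Sigma(b,c)$.
   Context: A PR-structure is a triple $\Sigma=(\mathsf{P}_\Sigma,\mathsf{R}_\Sigma,\rho^\Sigma)$ where $\mathsf{P}_\Sigma$ and $\mathsf{R}_\Sigma$ are non-empty sets and $\rho^\Sigma:\mathsf{P}_\Sigma\times\mathsf{P}_\Sigma\to\mathcal{P}(\mathsf{R}_\Sigma)$ is a function. For a set $I$ and functions $\varphi,\psi:I\to\mathsf{P}_\Sigma$, write $\varphi\vdash^\Sigma_I\psi$ iff $\bigcap_{i\in I}\rho^\Sigma(\varphi(i),\psi(i))\neq\emptyset$, i.e. iff there is $r\in\mathsf{R}_\Sigma$ with $r\in\rho^\Sigma(\varphi(i),\psi(i))$ for every $i\in I$. $\Sigma$ is called preorderal if for every set $I$ the relation $\vdash^\Sigma_I$ on $\mathsf{P}_\Sigma^I$ is a preorder (reflexive and transitive). -}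

module Defs where

open import Level using (Level; suc)
open import Relation.Binary.Core using (Rel)
open import Relation.Binary.PropositionalEquality.Core using (_≡_)
open import Relation.Binary.Structures using (IsPreorder)
open import Relation.Unary using (Pred; Satisfiable; ⋂)

-- "Set" is read as "type in Set ℓ" for one arbitrary level ℓ throughout: the
-- carriers, the subsets of R (predicates valued in Set ℓ), and the index sets.
record PRStructure (ℓ : Level) : Set (suc ℓ) where
  field
    P R        : Set ℓ
    P-nonempty : P
    R-nonempty : R
    ρ          : P → P → Pred R ℓ

  -- For an empty index set the intersection is all of R.
  Entails : (I : Set ℓ) → Rel (I → P) ℓ
  Entails I φ ψ = Satisfiable (⋂ I (λ i → ρ (φ i) (ψ i)))

  syntax Entails I φ ψ = φ ⊢[ I ] ψ

-- A preorder over _≡_ is exactly a reflexive and transitive relation.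
Preorderal : ∀ {ℓ} → PRStructure ℓ → Set (suc ℓ)
Preorderal {ℓ} Σ = (I : Set ℓ) → IsPreorder {A = I → P} _≡_ (Entails I)
  where open PRStructure Σ

{-# OPTIONS --safe #-}
-- A realizer for φ ⊢[ I ] ψ is uniform in I, so each condition is the
-- corresponding preorder axiom at a universal index set: P itself for
-- reflexivity, and the triples (a , b , c) with r ∈ ρ a b and s ∈ ρ b c for
-- transitivity.
module Submission where

open import Defs
open import Level using (Level)
open import Data.Product.Base using (_×_; _,_; ∃-syntax)
open import Function.Base using (id)
open import Function.Bundles using (_⇔_; mk⇔)
open import Relation.Binary.PropositionalEquality using (refl; isEquivalence)
open import Relation.Binary.Structures using (module IsPreorder)
open import Relation.Unary using (_∈_)

module _ {ℓ : Level} (Σ : PRStructure ℓ) where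
  open PRStructure Σ

  Identity : Set ℓ
  Identity = ∃[ i ] (∀ (a : P) → i ∈ ρ a a)

  Composition : Set ℓ
  Composition = ∀ (r s : R) → ∃[ s□r ] (∀ (a b c : P) → r ∈ ρ a b → s ∈ ρ b c → s□r ∈ ρ a c)

  -- Lives in `Set ℓ`, so it is itself an admissible index set. It may be empty, and then any
  -- realizer will do.
  record Composable (r s : R) : Set ℓ where
    constructor composable
    field
      {source middle target} : P
      first  : r ∈ ρ source middle
      second : s ∈ ρ middle target

  preorderal⇒identity : Preorderal Σ → Identity
  preorderal⇒identity pre = IsPreorder.refl (pre P) {id}

  preorderal⇒composition : Preorderal Σ → Composition
  preorderal⇒composition pre r s =
    let t , t∈ρ = IsPreorder.trans (pre (Composable r s))
                    -- The projections are the generic families: the fields `first` and `second` are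
                    -- exactly the proofs that `r` and `s` realize the two entailments.
                    {source} {middle} {target} (r , first) (s , second)
    in t , λ _ _ _ r∈ρab s∈ρbc → t∈ρ (composable r∈ρab s∈ρbc)
    where open Composable

  identity∧composition⇒preorderal : Identity × Composition → Preorderal Σ
  identity∧composition⇒preorderal ((i , i∈ρ) , _□_) I = record
    { isEquivalence = isEquivalence
    ; reflexive     = λ { {φ} refl → i , λ j → i∈ρ (φ j) }
    ; trans         = λ { {φ} {χ} {ψ} (r , r∈ρ) (s , s∈ρ) →
        -- `t` depends on `r` and `s` alone, hence is uniform in `j`.
        let t , t∈ρ = r □ s
        in t , λ j → t∈ρ (φ j) (χ j) (ψ j) (r∈ρ j) (s∈ρ j) }
    }

theorem2p19 : ∀ {ℓ : Level} (Σ : PRStructure ℓ) → let open PRStructure Σ in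
    Preorderal Σ
    ⇔ ( (∃[ i ] (∀ (a : P) → i ∈ ρ a a))
    × (∀ (r s : R) → ∃[ s□r ] (∀ (a b c : P) → r ∈ ρ a b → s ∈ ρ b c → s□r ∈ ρ a c)) )
theorem2p19 Σ = mk⇔
  (λ pre → preorderal⇒identity Σ pre , preorderal⇒composition Σ pre)
  (identity∧composition⇒preorderal Σ)
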